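{- Let $n\ge 2$ and let $a_1,\dots,a_n$ be positive integers. For $k\ge 1$ put $p_k=K(a_1,\dots,a_k)$, $q_k=K(a_2,\dots,a_k)$ and $r_k=K(a_3,\dots,a_k)$, so that $[a_1,\dots,a_n]=p_n/q_n$ and $[a_2,\dots,a_n]=q_n/r_n$. Then \[ [a_n,\dots,a_2,a_1,a_2,\dots,a_n]=\frac{p_n^2-r_n^2}{p_{n-1}p_n-r_{n-1}r_n}. \]
   Context: $[b_1,\dots,b_k]=b_1+\cfrac{1}{b_2+\cfrac{1}{\ddots+\cfrac{1}{b_k}}}$ denotes a continued fraction. For positive integers $a_i,\dots,a_j$, $K(a_i,\dots,a_j)$ denotes the continuant, i.e. the numerator of $[a_i,\dots,a_j]$ written in lowest terms; by convention $K(a_i,\dots,a_j)=1$ if $j=i-1$ (empty sequence) and $K(a_i,\dots,a_j)=0$ if $j=i-2$. -}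

module Defs where

open import Data.Bool using (if_then_else_)
open import Data.Integer using (ℤ; +_; 0ℤ; 1ℤ)
open import Data.List as List using (List; []; _∷_)
open import Data.Nat as ℕ using (ℕ; suc; _∸_; _<ᵇ_)
open import Data.Product using (Σ; Σ-syntax; _,_)
open import Data.Rational
  using (ℚ; ↥_; _/_; _+_; _÷_; 1/_; Positive; NonZero)
open import Data.Rational.Properties
  using (normalize-pos; pos+pos⇒pos; 1/pos⇒pos; pos⇒nonZero)
open import Data.Vec using (Vec; []; _∷_; fromList; toList)
open import Relation.Binary.PropositionalEquality using (_≡_)

ℕ⁺ : Set
ℕ⁺ = Σ[ n ∈ ℕ ] ℕ.NonZero n

toℚ : ℕ⁺ → ℚ
toℚ (n , _) = + n / 1

toℚ-pos : ∀ b → Positive (toℚ b)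
toℚ-pos (n , n≢0) = normalize-pos n 1 {{_}} {{n≢0}}

-- Defined together with its positivity, which is what makes the reciprocal
-- meaningful.
contFrac     : ∀ {k} → Vec ℕ⁺ (suc k) → ℚ
contFrac-pos : ∀ {k} (bs : Vec ℕ⁺ (suc k)) → Positive (contFrac bs)

contFrac (b ∷ [])         = toℚ b
contFrac (b ∷ bs@(_ ∷ _)) =
  toℚ b + (1/ contFrac bs) {{pos⇒nonZero (contFrac bs) {{contFrac-pos bs}}}}

contFrac-pos (b ∷ [])         = toℚ-pos b
contFrac-pos (b ∷ bs@(_ ∷ _)) =
  pos+pos⇒pos (toℚ b) {{toℚ-pos b}} _
    {{1/pos⇒pos (contFrac bs) {{contFrac-pos bs}}}}

-- ↥ is the numerator in lowest terms, since the fractions in ℚ are reduced.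
numerator : List ℕ⁺ → ℤ
numerator []       = 1ℤ
numerator (b ∷ bs) = ↥ contFrac (b ∷ fromList bs)

-- The entries a_i, …, a_j, numbered from 1.
segment : ∀ {n} → Vec ℕ⁺ n → ℕ → ℕ → List ℕ⁺
segment a i j = List.drop (i ∸ 1) (List.take j (toList a))

-- K a i j is K(a_i, …, a_j) for 1 ≤ i and j ≤ n.  The segment is empty both
-- for j = i - 1, where K is 1, and for j = i - 2, where K is 0, so the second
-- case has to be separated by the indices.
K : ∀ {n} → Vec ℕ⁺ n → ℕ → ℕ → ℤ
K a i j = if suc j <ᵇ i then 0ℤ else numerator (segment a i j)

infix 4 _≡_over_
_≡_over_ : ℚ → ℤ → ℤ → Set
x ≡ y over z =
  Σ[ z≢0 ∈ NonZero (z / 1) ] x ≡ ((y / 1) ÷ (z / 1)) {{z≢0}}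

{-# OPTIONS --safe #-}
-- The matrix of a list is the product of the matrices [[b,1],[1,0]] over its
-- entries b, and num and den are the coordinates of its action on (u , v).
-- Writing s = (a₂,…,aₙ), the matrix of a is [[pₙ,pₙ₋₁],[qₙ,qₙ₋₁]] and that of s
-- is [[qₙ,qₙ₋₁],[rₙ,rₙ₋₁]].  Reversal transposes the matrix, so the fraction of
-- (aₙ,…,a₂,a₁,…,aₙ) is
--   (qₙ pₙ + rₙ qₙ) / (qₙ₋₁ pₙ + rₙ₋₁ qₙ),
-- and it remains to expand by a₁, using a₁ qₖ = pₖ - rₖ.
module Submission where

open import Data.Integer using (ℤ; _-_; _*_; _^_)
open import Data.Nat using (ℕ; _+_; _∸_)
open import Data.Product using (_×_)
open import Data.Vec using (Vec; tail; reverse; _++_)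
open import Defs

import Data.Integer as ℤ
import Data.Integer.Properties as ℤ
import Data.Integer.Tactic.RingSolver as ℤ-Solver
import Data.List as List
import Data.Nat as ℕ
import Data.Nat.Properties as ℕ
import Data.Nat.Tactic.RingSolver as ℕ-Solver
import Data.Rational as ℚ
import Data.Rational.Properties as ℚ
import Data.Rational.Unnormalised as ℚᵘ
import Data.Rational.Unnormalised.Properties as ℚᵘ
open import Data.Integer using (+_)
open import Data.List using (List; []; _∷_; _ʳ++_)
open import Data.Nat using (suc)
open import Data.Nat.Coprimality using (Coprime; 1-coprimeTo)
open import Data.Nat.Divisibility using (∣m+n∣m⇒∣n; ∣n⇒∣m*n)
open import Data.Product using (_,_)
open import Data.Rational using (ℚ; mkℚ; *≡*; ↥_; _/_)
open import Data.Rational.Unnormalised using (mkℚᵘ)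
open import Data.Vec using ([]; _∷_; fromList; toList)
open import Data.Vec.Properties using (toList∘fromList; toList-ʳ++; unfold-ʳ++)
open import Relation.Binary.PropositionalEquality
  using (_≡_; refl; sym; trans; cong; cong₂; subst; module ≡-Reasoning)

-- Integers inside the rationals, and numerators in lowest terms.

/1-homo-+ : ∀ i j → (i ℤ.+ j) / 1 ≡ i / 1 ℚ.+ j / 1
/1-homo-+ i j = ℚ.toℚᵘ-injective (begin
  ℚ.toℚᵘ ((i ℤ.+ j) / 1)                ≈⟨ ℚ.toℚᵘ-fromℚᵘ (mkℚᵘ (i ℤ.+ j) 0) ⟩
  mkℚᵘ (i ℤ.+ j) 0                      ≈⟨ ℚᵘ.*≡* (cong (ℤ._* + 1) (sym (cong₂ ℤ._+_ (ℤ.*-identityʳ i) (ℤ.*-identityʳ j)))) ⟩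
  mkℚᵘ i 0 ℚᵘ.+ mkℚᵘ j 0                ≈⟨ ℚᵘ.+-cong (ℚ.toℚᵘ-fromℚᵘ (mkℚᵘ i 0)) (ℚ.toℚᵘ-fromℚᵘ (mkℚᵘ j 0)) ⟨
  ℚ.toℚᵘ (i / 1) ℚᵘ.+ ℚ.toℚᵘ (j / 1)    ≈⟨ ℚ.toℚᵘ-homo-+ (i / 1) (j / 1) ⟨
  ℚ.toℚᵘ (i / 1 ℚ.+ j / 1)              ∎)
  where open import Relation.Binary.Reasoning.Setoid ℚᵘ.≃-setoid

/1-homo-* : ∀ i j → (i ℤ.* j) / 1 ≡ (i / 1) ℚ.* (j / 1)
/1-homo-* i j = ℚ.toℚᵘ-injective (begin
  ℚ.toℚᵘ ((i ℤ.* j) / 1)                ≈⟨ ℚ.toℚᵘ-fromℚᵘ (mkℚᵘ (i ℤ.* j) 0) ⟩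
  mkℚᵘ i 0 ℚᵘ.* mkℚᵘ j 0                ≈⟨ ℚᵘ.*-cong (ℚ.toℚᵘ-fromℚᵘ (mkℚᵘ i 0)) (ℚ.toℚᵘ-fromℚᵘ (mkℚᵘ j 0)) ⟨
  ℚ.toℚᵘ (i / 1) ℚᵘ.* ℚ.toℚᵘ (j / 1)    ≈⟨ ℚ.toℚᵘ-homo-* (i / 1) (j / 1) ⟨
  ℚ.toℚᵘ ((i / 1) ℚ.* (j / 1))          ∎)
  where open import Relation.Binary.Reasoning.Setoid ℚᵘ.≃-setoid

-- A coprime pair `u`, `v` already forms a reduced fraction, and two reduced fractions that agree
-- after cross-multiplication are identical.
↥-coprime : ∀ x u v .{{_ : ℕ.NonZero v}} → Coprime u v →
            x ℚ.* (+ v / 1) ≡ + u / 1 → ↥ x ≡ + u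
↥-coprime x@(mkℚ n d _) u v@(suc _) u⊥v xv≡u = cong ↥_ (ℚ.≃⇒≡ {x} {ℚ.mkℚ+ u v u⊥v} (*≡* nv≡ud))
  where
  xv≃u : ℚ.toℚᵘ x ℚᵘ.* mkℚᵘ (+ v) 0 ℚᵘ.≃ mkℚᵘ (+ u) 0
  xv≃u = begin
    ℚ.toℚᵘ x ℚᵘ.* mkℚᵘ (+ v) 0           ≈⟨ ℚᵘ.*-congˡ {ℚ.toℚᵘ x} (ℚ.toℚᵘ-fromℚᵘ (mkℚᵘ (+ v) 0)) ⟨
    ℚ.toℚᵘ x ℚᵘ.* ℚ.toℚᵘ (+ v / 1)       ≈⟨ ℚ.toℚᵘ-homo-* x (+ v / 1) ⟨
    ℚ.toℚᵘ (x ℚ.* (+ v / 1))             ≡⟨ cong ℚ.toℚᵘ xv≡u ⟩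
    ℚ.toℚᵘ (+ u / 1)                     ≈⟨ ℚ.toℚᵘ-fromℚᵘ (mkℚᵘ (+ u) 0) ⟩
    mkℚᵘ (+ u) 0                         ∎
    where open import Relation.Binary.Reasoning.Setoid ℚᵘ.≃-setoid

  nv≡ud : n ℤ.* + v ≡ + u ℤ.* + suc d
  nv≡ud = begin
    n ℤ.* + v                 ≡⟨ ℤ.*-identityʳ (n ℤ.* + v) ⟨
    n ℤ.* + v ℤ.* + 1         ≡⟨ ℚᵘ.drop-*≡* xv≃u ⟩
    + u ℤ.* + (suc d ℕ.* 1)   ≡⟨ cong (λ e → + u ℤ.* + e) (ℕ.*-identityʳ (suc d)) ⟩
    + u ℤ.* + suc d           ∎
    where open ≡-Reasoning

-- Knowing `z` as a nonzero natural number supplies the invertibility that `_≡_over_` demands.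
≡-over : ∀ {x} y z c .{{_ : ℕ.NonZero c}} → z ≡ + c →
         x ℚ.* (z / 1) ≡ y / 1 → x ≡ y over z
≡-over {x} y .(+ c) c refl xc≡y = c≢0 , (begin
  x                                       ≡⟨ ℚ.*-identityʳ x ⟨
  x ℚ.* ℚ.1ℚ                              ≡⟨ cong (x ℚ.*_) (ℚ.*-inverseʳ (+ c / 1) {{c≢0}}) ⟨
  x ℚ.* ((+ c / 1) ℚ.* (ℚ.1/ (+ c / 1)) {{c≢0}}) ≡⟨ ℚ.*-assoc x (+ c / 1) _ ⟨
  x ℚ.* (+ c / 1) ℚ.* (ℚ.1/ (+ c / 1)) {{c≢0}}   ≡⟨ cong (λ w → w ℚ.* (ℚ.1/ (+ c / 1)) {{c≢0}}) xc≡y ⟩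
  ((y / 1) ℚ.÷ (+ c / 1)) {{c≢0}}         ∎)
  where
  open ≡-Reasoning
  c≢0 = ℚ.pos⇒nonZero (+ c / 1) {{ℚ.normalize-pos c 1}}

-- Matrix coordinates of a continued fraction.

num den : List ℕ⁺ → ℕ → ℕ → ℕ
num []             u v = u
num ((b , _) ∷ bs) u v = b ℕ.* num bs u v + den bs u v
den []             u v = v
den (_ ∷ bs)       u v = num bs u v

num-nonZero : ∀ bs → ℕ.NonZero (num bs 1 0)
num-nonZero []                 = _
-- As the entry is `suc b`, one summand is `num bs 1 0` itself, and the others only add to it.
num-nonZero ((suc b , _) ∷ bs) = ℕ.>-nonZero (ℕ.≤-trans
  (ℕ.>-nonZero⁻¹ (num bs 1 0) {{num-nonZero bs}})
  (ℕ.≤-trans (ℕ.m≤m+n _ (b ℕ.* num bs 1 0)) (ℕ.m≤m+n _ (den bs 1 0))))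

-- A step of Euclid's algorithm: a common divisor of `b * n + d` and `n` divides `d`.
num-den-coprime : ∀ bs → Coprime (num bs 1 0) (den bs 1 0)
num-den-coprime []             = 1-coprimeTo 0
num-den-coprime ((b , _) ∷ bs) (d∣n , d∣d) =
  num-den-coprime bs (d∣d , ∣m+n∣m⇒∣n d∣n (∣n⇒∣m*n b d∣d))

module _ {u v : ℕ} where

  private
    step : ∀ b x y s t → x ℕ.* (b ℕ.* s + t) + y ℕ.* s ≡ (b ℕ.* x + y) ℕ.* s + x ℕ.* t
    step = ℕ-Solver.solve-∀

  -- Each factor [[b,1],[1,0]] is symmetric, so reversing `xs` transposes its matrix: its first
  -- column becomes the row used here, its second column the row in `den-ʳ++`. The induction moves
  -- the head of `xs` onto `ys`, so `ys` stays arbitrary.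
  num-ʳ++ : ∀ xs ys → num (xs ʳ++ ys) u v ≡
            num xs 1 0 ℕ.* num ys u v + den xs 1 0 ℕ.* den ys u v
  num-ʳ++ []               ys = sym (trans (ℕ.+-identityʳ _) (ℕ.*-identityˡ (num ys u v)))
  num-ʳ++ ((b , b≢0) ∷ xs) ys = trans (num-ʳ++ xs ((b , b≢0) ∷ ys))
    (step b (num xs 1 0) (den xs 1 0) (num ys u v) (den ys u v))

  den-ʳ++ : ∀ xs ys → den (xs ʳ++ ys) u v ≡
            num xs 0 1 ℕ.* num ys u v + den xs 0 1 ℕ.* den ys u v
  den-ʳ++ []               ys = sym (ℕ.*-identityˡ (den ys u v))
  den-ʳ++ ((b , b≢0) ∷ xs) ys = trans (den-ʳ++ xs ((b , b≢0) ∷ ys))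
    (step b (num xs 0 1) (den xs 0 1) (num ys u v) (den ys u v))

-- Appending b sends (0 , 1) to (1 , 0), so dropping the last entry turns the
-- first column of the matrix into the second.
num-take : ∀ {k} (bs : Vec ℕ⁺ (suc k)) → num (List.take k (toList bs)) 1 0 ≡ num (toList bs) 0 1
den-take : ∀ {k} (bs : Vec ℕ⁺ (suc k)) → den (List.take k (toList bs)) 1 0 ≡ den (toList bs) 0 1
num-take ((b , _) ∷ [])         = cong (_+ 1) (sym (ℕ.*-zeroʳ b))
num-take ((b , _) ∷ bs@(_ ∷ _)) = cong₂ (λ x y → b ℕ.* x + y) (num-take bs) (den-take bs)
den-take (_ ∷ [])               = refl
den-take (_ ∷ bs@(_ ∷ _))       = num-take bs

-- Inductively `ν` is `x * δ`, so in the product of `β + 1/x` with the new denominator `ν` the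
-- second term collapses to `δ`.
contFrac-num-den : ∀ {k} (bs : Vec ℕ⁺ (suc k)) →
  contFrac bs ℚ.* (+ den (toList bs) 1 0 / 1) ≡ + num (toList bs) 1 0 / 1
contFrac-num-den ((b , _) ∷ []) = trans (ℚ.*-identityʳ (+ b / 1))
  (cong (λ n → + n / 1) (sym (trans (ℕ.+-identityʳ _) (ℕ.*-identityʳ b))))
contFrac-num-den ((b , _) ∷ bs@(_ ∷ _)) = begin
  (β ℚ.+ 1/x) ℚ.* ν                 ≡⟨ ℚ.*-distribʳ-+ ν β 1/x ⟩
  β ℚ.* ν ℚ.+ 1/x ℚ.* ν             ≡⟨ cong (λ w → β ℚ.* ν ℚ.+ 1/x ℚ.* w) (contFrac-num-den bs) ⟨
  β ℚ.* ν ℚ.+ 1/x ℚ.* (x ℚ.* δ)     ≡⟨ cong (β ℚ.* ν ℚ.+_) (ℚ.*-assoc 1/x x δ) ⟨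
  β ℚ.* ν ℚ.+ 1/x ℚ.* x ℚ.* δ       ≡⟨ cong (λ w → β ℚ.* ν ℚ.+ w ℚ.* δ) (ℚ.*-inverseˡ x {{x≢0}}) ⟩
  β ℚ.* ν ℚ.+ ℚ.1ℚ ℚ.* δ            ≡⟨ cong (β ℚ.* ν ℚ.+_) (ℚ.*-identityˡ δ) ⟩
  β ℚ.* ν ℚ.+ δ                     ≡⟨ cong (ℚ._+ δ) (/1-homo-* (+ b) (+ n)) ⟨
  ((+ b ℤ.* + n) / 1) ℚ.+ δ         ≡⟨ /1-homo-+ (+ b ℤ.* + n) (+ d) ⟨
  (+ b ℤ.* + n ℤ.+ + d) / 1         ≡⟨ cong (λ w → (w ℤ.+ + d) / 1) (ℤ.pos-* b n) ⟨
  + (b ℕ.* n + d) / 1               ∎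
  where
  open ≡-Reasoning
  n = num (toList bs) 1 0
  d = den (toList bs) 1 0
  x = contFrac bs
  x≢0 = ℚ.pos⇒nonZero x {{contFrac-pos bs}}
  1/x = (ℚ.1/ x) {{x≢0}}
  β = + b / 1
  ν = + n / 1
  δ = + d / 1

-- Coprimality puts `num` over `den` in lowest terms, which turns continuants into matrix entries.
-- The transport is there because `numerator` passes through `fromList`.
numerator≡num : ∀ bs → numerator bs ≡ + num bs 1 0
numerator≡num []       = refl
numerator≡num (b ∷ bs) = subst (λ l → ↥ contFrac (b ∷ fromList bs) ≡ + num (b ∷ l) 1 0)
  (toList∘fromList bs)
  (↥-coprime (contFrac (b ∷ fromList bs)) _ _ {{num-nonZero (toList (fromList bs))}}
    (num-den-coprime (b ∷ toList (fromList bs)))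
    (contFrac-num-den (b ∷ fromList bs)))

-- The factor `c` admits fractions that are not in lowest terms.
contFrac-over : ∀ {k} (bs : Vec ℕ⁺ (suc k)) c .{{_ : ℕ.NonZero c}} {y z} →
  y ≡ + c * + num (toList bs) 1 0 → z ≡ + c * + den (toList bs) 1 0 →
  contFrac bs ≡ y over z
contFrac-over bs@(_ ∷ bs′) c {{c≢0}} {y} {z} refl refl =
  -- `d` is `num` of the tail `bs′`, hence nonzero.
  ≡-over y z (c ℕ.* d) {{ℕ.m*n≢0 c d {{c≢0}} {{num-nonZero (toList bs′)}}}} (sym (ℤ.pos-* c d)) (begin
    x ℚ.* ((+ c * + d) / 1)     ≡⟨ cong (x ℚ.*_) (/1-homo-* (+ c) (+ d)) ⟩
    x ℚ.* (γ ℚ.* δ)             ≡⟨ ℚ.*-assoc x γ δ ⟨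
    x ℚ.* γ ℚ.* δ               ≡⟨ cong (ℚ._* δ) (ℚ.*-comm x γ) ⟩
    γ ℚ.* x ℚ.* δ               ≡⟨ ℚ.*-assoc γ x δ ⟩
    γ ℚ.* (x ℚ.* δ)             ≡⟨ cong (γ ℚ.*_) (contFrac-num-den bs) ⟩
    γ ℚ.* (+ n / 1)             ≡⟨ /1-homo-* (+ c) (+ n) ⟨
    (+ c * + n) / 1             ∎)
  where
  open ≡-Reasoning
  n = num (toList bs) 1 0
  d = den (toList bs) 1 0
  x = contFrac bs
  γ = + c / 1
  δ = + d / 1

-- Segments, reversal and the palindromic fraction.

take-toList : ∀ {A : Set} {k} (xs : Vec A k) → List.take k (toList xs) ≡ toList xs
take-toList []       = refl
take-toList (x ∷ xs) = cong (x ∷_) (take-toList xs)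

toList-reverse-++ : ∀ {A : Set} {k l} (xs : Vec A k) (ys : Vec A l) →
                    toList (reverse xs ++ ys) ≡ toList xs ʳ++ toList ys
toList-reverse-++ xs ys = trans (cong toList (sym (unfold-ʳ++ xs ys))) (toList-ʳ++ xs)

theorem3p15 : (m : ℕ) → let n = 2 + m in
    (a : Vec ℕ⁺ n) →
    let p = λ (k : ℕ) → K a 1 k
        q = λ (k : ℕ) → K a 2 k
        r = λ (k : ℕ) → K a 3 k
    in
    (contFrac a ≡ p n over q n) ×
    (contFrac (tail a) ≡ q n over r n) ×
    (contFrac (reverse (tail a) ++ a)
      ≡ (p n ^ 2 - r n ^ 2) over (p (n ∸ 1) * p n - r (n ∸ 1) * r n))
theorem3p15 m a@(a₁@(α , α≢0) ∷ s@(a₂ ∷ t)) =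
    contFrac-over a 1 (trans p≡ (sym (ℤ.*-identityˡ _))) (trans q≡ (sym (ℤ.*-identityˡ _)))
  , contFrac-over s 1 (trans q≡ (sym (ℤ.*-identityˡ _))) (trans r≡ (sym (ℤ.*-identityˡ _)))
  -- Both sides of the claimed fraction are a₁ times the matrix coordinates.
  , contFrac-over (reverse s ++ a) α {{α≢0}} numerators denominators
  where
  open ≡-Reasoning
  n = 2 + m
  N = toList (reverse s ++ a)
  Q  = num (toList s) 1 0
  R  = den (toList s) 1 0
  Q′ = num (toList s) 0 1
  R′ = den (toList s) 0 1

  pos-αx+y : ∀ x y → + (α ℕ.* x + y) ≡ + α * + x ℤ.+ + y
  pos-αx+y x y = cong (ℤ._+ + y) (ℤ.pos-* α x)

  p≡ : K a 1 n ≡ + num (toList a) 1 0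
  p≡ = trans (cong numerator (take-toList a)) (numerator≡num (toList a))

  q≡ : K a 2 n ≡ + Q
  q≡ = trans (cong numerator (take-toList s)) (numerator≡num (toList s))

  r≡ : K a 3 n ≡ + R
  -- `R` unfolds to `num (toList t) 1 0`, which is 1 when `t` is empty.
  r≡ = trans (cong numerator (take-toList t)) (numerator≡num (toList t))

  p′≡ : K a 1 (1 + m) ≡ + num (toList a) 0 1
  p′≡ = trans (numerator≡num (List.take (1 + m) (toList a))) (cong +_ (num-take a))

  r′≡ : ∀ {k} (bs : Vec ℕ⁺ k) → K (a₁ ∷ a₂ ∷ bs) 3 (1 + k) ≡ + num (toList bs) 0 1
  -- Here n = 2, and r₁ = K(a₃,...,a₁) is 0 by the convention for j = i - 2.
  r′≡             []         = refl
  r′≡ {k = suc k} bs@(_ ∷ _) = trans (numerator≡num (List.take k (toList bs))) (cong +_ (num-take bs))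

  numerators : K a 1 n ^ 2 - K a 3 n ^ 2 ≡ + α * + num N 1 0
  numerators = begin
    K a 1 n ^ 2 - K a 3 n ^ 2                     ≡⟨ cong₂ (λ x y → x ^ 2 - y ^ 2) (trans p≡ (pos-αx+y Q R)) r≡ ⟩
    -- This is (p - r)(p + r), where p - r = α q.
    (+ α * + Q ℤ.+ + R) ^ 2 - (+ R) ^ 2           ≡⟨ expand (+ α) (+ Q) (+ R) ⟩
    + α * (+ Q * (+ α * + Q ℤ.+ + R) ℤ.+ + R * + Q) ≡⟨ cong (+ α *_) N≡ ⟨
    + α * + num N 1 0                             ∎
    where
    -- x ^ 2 unfolds to x * (x * 1ℤ).
    expand : ∀ a x y → (a * x ℤ.+ y) * ((a * x ℤ.+ y) * ℤ.1ℤ) - y * (y * ℤ.1ℤ) ≡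
                       a * (x * (a * x ℤ.+ y) ℤ.+ y * x)
    expand = ℤ-Solver.solve-∀

    N≡ : + num N 1 0 ≡ + Q * (+ α * + Q ℤ.+ + R) ℤ.+ + R * + Q
    N≡ = begin
      + num N 1 0                                 ≡⟨ cong (λ l → + num l 1 0) (toList-reverse-++ s a) ⟩
      + num (toList s ʳ++ toList a) 1 0           ≡⟨ cong +_ (num-ʳ++ (toList s) (toList a)) ⟩
      -- The coordinates of `a` unfold to `α * Q + R` and `Q`.
      + (Q ℕ.* (α ℕ.* Q + R) + R ℕ.* Q)           ≡⟨ cong₂ ℤ._+_ (ℤ.pos-* Q _) (ℤ.pos-* R Q) ⟩
      + Q * + (α ℕ.* Q + R) ℤ.+ + R * + Q         ≡⟨ cong (λ w → + Q * w ℤ.+ + R * + Q) (pos-αx+y Q R) ⟩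
      + Q * (+ α * + Q ℤ.+ + R) ℤ.+ + R * + Q     ∎

  denominators : K a 1 (1 + m) * K a 1 n - K a 3 (1 + m) * K a 3 n ≡ + α * + den N 1 0
  denominators = begin
    K a 1 (1 + m) * K a 1 n - K a 3 (1 + m) * K a 3 n
      ≡⟨ cong₂ _-_ (cong₂ _*_ (trans p′≡ (pos-αx+y Q′ R′)) (trans p≡ (pos-αx+y Q R))) (cong₂ _*_ (r′≡ t) r≡) ⟩
    (+ α * + Q′ ℤ.+ + R′) * (+ α * + Q ℤ.+ + R) - + R′ * + R
      ≡⟨ expand (+ α) (+ Q) (+ R) (+ Q′) (+ R′) ⟩
    + α * (+ Q′ * (+ α * + Q ℤ.+ + R) ℤ.+ + R′ * + Q)
      ≡⟨ cong (+ α *_) D≡ ⟨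
    + α * + den N 1 0 ∎
    where
    -- With p = a x + y and p′ = a x′ + y′, the left side is (p′ - y′) p + y′ (p - y), and both
    -- differences are multiples of `a`.
    expand : ∀ a x y x′ y′ → (a * x′ ℤ.+ y′) * (a * x ℤ.+ y) - y′ * y ≡
                             a * (x′ * (a * x ℤ.+ y) ℤ.+ y′ * x)
    expand = ℤ-Solver.solve-∀

    D≡ : + den N 1 0 ≡ + Q′ * (+ α * + Q ℤ.+ + R) ℤ.+ + R′ * + Q
    D≡ = begin
      + den N 1 0                                 ≡⟨ cong (λ l → + den l 1 0) (toList-reverse-++ s a) ⟩
      + den (toList s ʳ++ toList a) 1 0           ≡⟨ cong +_ (den-ʳ++ (toList s) (toList a)) ⟩
      + (Q′ ℕ.* (α ℕ.* Q + R) + R′ ℕ.* Q)         ≡⟨ cong₂ ℤ._+_ (ℤ.pos-* Q′ _) (ℤ.pos-* R′ Q) ⟩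
      + Q′ * + (α ℕ.* Q + R) ℤ.+ + R′ * + Q       ≡⟨ cong (λ w → + Q′ * w ℤ.+ + R′ * + Q) (pos-αx+y Q R) ⟩
      + Q′ * (+ α * + Q ℤ.+ + R) ℤ.+ + R′ * + Q   ∎
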